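{- For every integer $k\ge 1$, let $G_k$ be the graph consisting of a path $u_1u_2\cdots u_{2^k-1}$ together with an independent set $\{v_0,\dots,v_{k-1}\}$ disjoint from the path, where $v_i$ is adjacent to $u_j$ if and only if $i$ is the largest integer such that $2^i$ divides $j$ (and there are no other edges). Then $G_k$ has $2^k+k-1$ vertices, is $\mathcal{O}_2$-free, does not contain $K_{3,3}$ as a subgraph, and has treewidth exactly $k$.
   Context: All graphs are finite and simple. Two vertex-disjoint subgraphs are independent if there is no edge between them. A graph is $\mathcal{O}_2$-free if it does not contain two vertex-disjoint cycles with no edge between them; equivalently, it has no induced subgraph that is a disjoint union of two cycles. -}

module Defs where

open import Data.Empty using (⊥)
open import Data.Fin using (Fin; zero; suc; toℕ; fromℕ; inject₁)
open import Data.Fin.Properties using (+↔⊎)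
open import Data.Fin.Subset using (Subset; ∣_∣) renaming (_∈_ to _∈ˢ_)
open import Data.List using (tabulate)
open import Data.List.Extrema.Nat using (max)
open import Data.Nat using (ℕ; suc; _+_; _∸_; _^_; _≤_)
open import Data.Nat.Divisibility using (_∣_; _∣?_; ∣-trans; m∣m*n)
open import Data.Nat.Properties using (_≟_; ≮⇒≥; 1+n≰n; 1+n≢n; m≤n⇒∃[o]m+o≡n; ^-distribˡ-+-*)
open import Data.Product using (Σ-syntax; ∃-syntax; _×_; _,_)
open import Data.Sum using (_⊎_; inj₁; inj₂; swap)
open import Data.Unit using (⊤; tt)
open import Function using (_↔_; Inverse)
open import Function.Construct.Symmetry using (↔-sym)
open import Function.Definitions using (Injective)
open import Level using (0ℓ)
open import Relation.Binary.Core using (Rel)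
open import Relation.Binary.Construct.Closure.ReflexiveTransitive using (Star)
open import Relation.Binary.Definitions using (Symmetric; Irreflexive; Decidable)
open import Relation.Binary.PropositionalEquality using (_≡_; _≢_; refl; sym; subst)
open import Relation.Nullary using (¬_; Dec; yes; no)
open import Relation.Nullary.Decidable using (map′; _×-dec_; _⊎-dec_; ¬?)
open import Relation.Unary using (Pred)

record Graph : Set₁ where
  infix 4 _~_ _~?_
  field
    Vertex   : Set
    order    : ℕ
    finite   : Vertex ↔ Fin order
    _~_      : Rel Vertex 0ℓ
    _~?_     : Decidable _~_
    ~-sym    : Symmetric _~_
    ~-irrefl : Irreflexive _≡_ _~_

  index : Vertex → Fin order
  index = Inverse.to finite

  vertexAt : Fin order → Vertex
  vertexAt = Inverse.from finite

-- Not necessarily induced subgraph.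
_⊑_ : Graph → Graph → Set
H ⊑ G = Σ[ f ∈ (H.Vertex → G.Vertex) ]
          Injective _≡_ _≡_ f × (∀ {x y} → x H.~ y → f x G.~ f y)
  where
  module H = Graph H
  module G = Graph G

module _ (G : Graph) where
  open Graph G

  record Cycle : Set where
    field
      extra     : ℕ
      -- The length is 3 + extra.
      at        : Fin (3 + extra) → Vertex
      distinct  : Injective _≡_ _≡_ at
      adjacent  : ∀ (i : Fin (2 + extra)) → at (inject₁ i) ~ at (suc i)
      closing   : at (fromℕ (2 + extra)) ~ at zero

  Independent : Rel Cycle 0ℓ
  Independent C D = ∀ i j → C.at i ≢ D.at j × ¬ (C.at i ~ D.at j)
    where
    module C = Cycle C
    module D = Cycle D

  O₂-Free : Set
  O₂-Free = ¬ (∃[ C ] ∃[ D ] Independent C D)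

  -- The subgraph induced by P is connected; it may be empty.
  ConnectedOn : Pred Vertex 0ℓ → Set
  ConnectedOn P =
    ∀ {x y} → P x → P y → Star (λ a b → P a × P b × a ~ b) x y

  record IsTree : Set where
    field
      nonempty  : Vertex
      connected : ∀ x y → Star _~_ x y
      acyclic   : ¬ Cycle

record TreeDecomposition (G : Graph) : Set₁ where
  private module G = Graph G
  field
    tree   : Graph
    isTree : IsTree tree

  private module T = Graph tree

  field
    bag : T.Vertex → Subset G.order

  _∈bag_ : G.Vertex → T.Vertex → Set
  x ∈bag t = G.index x ∈ˢ bag t

  field
    coversVertices : ∀ x → ∃[ t ] x ∈bag t
    coversEdges    : ∀ {x y} → x G.~ y → ∃[ t ] (x ∈bag t × y ∈bag t)
    coherent       : ∀ x → ConnectedOn tree (x ∈bag_)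

  -- Truncated subtraction is exact as soon as G has a vertex, since some bag
  -- is then nonempty.
  width : ℕ
  width = max 0 (tabulate (λ i → ∣ bag (T.vertexAt i) ∣)) ∸ 1

HasTreewidth : Graph → ℕ → Set₁
HasTreewidth G w =
    (Σ[ D ∈ TreeDecomposition G ] TreeDecomposition.width D ≡ w)
  × (∀ (D : TreeDecomposition G) → w ≤ TreeDecomposition.width D)

completeBipartite : ℕ → ℕ → Graph
completeBipartite m n = record
  { Vertex   = Fin m ⊎ Fin n
  ; order    = m + n
  ; finite   = ↔-sym +↔⊎
  ; _~_      = adj
  ; _~?_     = adj?
  ; ~-sym    = λ {x} {y} → adj-sym x y
  ; ~-irrefl = λ { {x} refl → adj-irrefl x }
  }
  where
  adj : Rel (Fin m ⊎ Fin n) 0ℓ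
  adj (inj₁ _) (inj₁ _) = ⊥
  adj (inj₁ _) (inj₂ _) = ⊤
  adj (inj₂ _) (inj₁ _) = ⊤
  adj (inj₂ _) (inj₂ _) = ⊥

  adj? : Decidable adj
  adj? (inj₁ _) (inj₁ _) = no λ ()
  adj? (inj₁ _) (inj₂ _) = yes tt
  adj? (inj₂ _) (inj₁ _) = yes tt
  adj? (inj₂ _) (inj₂ _) = no λ ()

  adj-sym : ∀ x y → adj x y → adj y x
  adj-sym (inj₁ _) (inj₂ _) _ = tt
  adj-sym (inj₂ _) (inj₁ _) _ = tt

  adj-irrefl : ∀ x → ¬ adj x x
  adj-irrefl (inj₁ _) ()
  adj-irrefl (inj₂ _) ()

IsLargestPower : ℕ → ℕ → Set
IsLargestPower i j = 2 ^ i ∣ j × (∀ m → 2 ^ m ∣ j → m ≤ i)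

isLargestPower? : ∀ i j → Dec (IsLargestPower i j)
isLargestPower? i j =
  map′ (λ (p , q) → p , λ m d → ≮⇒≥ λ i<m → q (∣-trans (2^-mono i<m) d))
       (λ (p , q) → p , λ d → 1+n≰n (q (suc i) d))
       ((2 ^ i ∣? j) ×-dec ¬? (2 ^ suc i ∣? j))
  where
  2^-mono : ∀ {a b} → a ≤ b → 2 ^ a ∣ 2 ^ b
  2^-mono {a} a≤b with m≤n⇒∃[o]m+o≡n a≤b
  ... | o , refl = subst (2 ^ a ∣_) (sym (^-distribˡ-+-* 2 a o)) (m∣m*n (2 ^ o))

module _ (k : ℕ) where

  GkVertex : Set
  GkVertex = Fin (2 ^ k ∸ 1) ⊎ Fin k

  pattern u p = inj₁ p
  pattern v i = inj₂ i

  -- u p is the path vertex written u_j with j = pos p, so j runs over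
  -- 1, …, 2^k - 1; v i is v_i with i running over 0, …, k - 1.
  pos : Fin (2 ^ k ∸ 1) → ℕ
  pos p = suc (toℕ p)

  GkAdj : Rel GkVertex 0ℓ
  GkAdj (u p) (u q) = pos q ≡ suc (pos p) ⊎ pos p ≡ suc (pos q)
  GkAdj (u p) (v i) = IsLargestPower (toℕ i) (pos p)
  GkAdj (v i) (u p) = IsLargestPower (toℕ i) (pos p)
  GkAdj (v _) (v _) = ⊥

  G : Graph
  G = record
    { Vertex   = GkVertex
    ; order    = (2 ^ k ∸ 1) + k
    ; finite   = ↔-sym +↔⊎
    ; _~_      = GkAdj
    ; _~?_     = adj?
    ; ~-sym    = λ {x} {y} → adj-sym x y
    ; ~-irrefl = λ { {x} refl → adj-irrefl x }
    }
    where
    adj? : Decidable GkAdj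
    adj? (u p) (u q) = (pos q ≟ suc (pos p)) ⊎-dec (pos p ≟ suc (pos q))
    adj? (u p) (v i) = isLargestPower? (toℕ i) (pos p)
    adj? (v i) (u p) = isLargestPower? (toℕ i) (pos p)
    adj? (v _) (v _) = no λ ()

    adj-sym : ∀ x y → GkAdj x y → GkAdj y x
    adj-sym (u _) (u _) e = swap e
    adj-sym (u _) (v _) e = e
    adj-sym (v _) (u _) e = e

    adj-irrefl : ∀ x → ¬ GkAdj x x
    adj-irrefl (u p) (inj₁ e) = 1+n≢n (sym e)
    adj-irrefl (u p) (inj₂ e) = 1+n≢n (sym e)
    adj-irrefl (v _) ()

{-# OPTIONS --safe #-}

-- O₂-freeness.  Every cycle uses some v_i.  If C uses v_a and is independent of a
-- cycle through v_b with b < a, then C avoids the vertices u_j of valuation b, so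
-- after entering the path next to v_a it is caught in an interval of radius 2^b
-- around its entry point and must leave it through some v_c with c < b.  Swapping
-- the roles of the two cycles gives an infinite descent.
--
-- K₃,₃-freeness.  Distinct v_i have no common neighbour, so each side contains at
-- most one of them, and some u_j would have three neighbours on the path.
--
-- Treewidth.  A path decomposition has width k since the last v_i has only one
-- neighbour.  Conversely {v_0}, {u_1, u_2, v_1} and {u_j : 2^(i-1) < j ≤ 2^i} ∪ {v_i}
-- for 2 ≤ i ≤ k, restricted to the vertices of G_k, are the branch sets of a K_{k+1}
-- minor; by the Helly property of subtrees some bag meets all of them.

module Submission where

open import Defs
open import Data.Empty using (⊥; ⊥-elim)
open import Data.Fin using (Fin; zero; suc; toℕ; fromℕ; fromℕ<; inject₁)
open import Data.Fin.Patterns using (0F; 1F; 2F)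
open import Data.Fin.Properties using
  (all?; any?; ¬∀⟶∃¬; injective⇒≤; toℕ-injective; toℕ-fromℕ; toℕ-fromℕ<; toℕ-inject₁;
   toℕ<n; toℕ≤pred[n]; fromℕ≢inject₁)
  renaming (_≟_ to _≟ᶠ_; suc-injective to suc-injectiveᶠ)
open import Data.Fin.Relation.Unary.Top using (view; ‵fromℕ; ‵inject₁)
open import Data.Fin.Subset using (Subset; ∣_∣; inside; outside; ⁅_⁆; _∪_)
  renaming (_∈_ to _∈ˢ_; ⊥ to ∅; _-_ to _∖_)
open import Data.Fin.Subset.Properties using
  (∪-identityˡ; ∣⊥∣≡0; ∉⊥; x∈⁅x⁆; x∈⁅y⁆⇒x≡y; x∈p∪q⁺; x∈p∪q⁻; x∈p⇒∣p-x∣<∣p∣; x∈p∧x≢y⇒x∈p-y)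
  renaming (_∈?_ to _∈ˢ?_)
open import Data.List using (List; []; _∷_; length; lookup; foldr; map; tabulate)
open import Data.List.Extrema.Nat using (max; xs≤max; max≤v⁺)
open import Data.List.Membership.Propositional using (_∈_)
open import Data.List.Membership.Propositional.Properties using
  (∈-lookup; ∈-map⁺; ∈-map⁻; ∈-tabulate⁺; ∈-tabulate⁻)
import Data.List.Membership.DecPropositional as DecMembership
open import Data.List.Properties using (length-map; length-tabulate)
open import Data.List.Relation.Unary.All as All using (All; []; _∷_)
open import Data.List.Relation.Unary.All.Properties using (¬Any⇒All¬; tabulate⁺; tabulate⁻)
open import Data.List.Relation.Unary.AllPairs using ([]; _∷_)
open import Data.List.Relation.Unary.Any using (here; there)
open import Data.List.Relation.Unary.Unique.Propositional using (Unique)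
open import Data.Nat using (ℕ; zero; suc; _+_; _*_; _∸_; _^_; _≤_; _<_; z≤n; s≤s; z<s)
open import Data.Nat.Divisibility
open import Data.Nat.Induction using (<-wellFounded)
open import Data.Nat.Properties
open import Data.Product using (∃-syntax; _×_; _,_; proj₁; proj₂)
open import Data.Sum using (_⊎_; inj₁; inj₂; [_,_]′; swap)
open import Data.Sum.Properties using (inj₂-injective)
open import Data.Vec using ([]; _∷_)
open import Function using (_∘_; id; Inverse)
open import Function.Construct.Identity using (↔-id)
open import Function.Definitions using (Injective)
open import Induction.WellFounded using (Acc; acc)
open import Level using (0ℓ)
open import Relation.Binary.Core using (Rel)
open import Relation.Binary.Construct.Closure.ReflexiveTransitive as Star
  using (Star; ε; _◅_; _◅◅_)
open import Relation.Binary.Definitions using (DecidableEquality; Symmetric; tri<; tri≈; tri>)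
open import Relation.Binary.PropositionalEquality
open import Relation.Nullary using (¬_; Dec; yes; no; contradiction)
open import Relation.Nullary.Decidable using (map′; _×-dec_; _⊎-dec_)
open import Relation.Unary using (Pred; Decidable)

-- Walks, loop erasure and cycles

-- The list omits the starting vertex, so `x ∷ xs` is the whole vertex sequence and
-- `lookup (x ∷ xs)` can serve as `at` of a `Cycle`.
data Trail {V : Set} (R : Rel V 0ℓ) : V → List V → V → Set where
  stop : ∀ {x} → Trail R x [] x
  step : ∀ {x y z ys} → R x y → Trail R y ys z → Trail R x (y ∷ ys) z

module _ {V : Set} {R : Rel V 0ℓ} where

  suffix : ∀ {x y z ys} → x ∈ y ∷ ys → Trail R y ys z → Unique (y ∷ ys) →
           ∃[ xs ] Trail R x xs z × Unique (x ∷ xs)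
  suffix (here refl) t          uniq       = _ , t , uniq
  suffix (there x∈)  (step _ t) (_ ∷ uniq) = suffix x∈ t uniq

  loop-erase : DecidableEquality V → ∀ {x y} → Star R x y →
               ∃[ xs ] Trail R x xs y × Unique (x ∷ xs)
  loop-erase _≟_ ε = [] , stop , [] ∷ []
  loop-erase _≟_ {x} (_◅_ {j = y} r w) with loop-erase _≟_ w
  ... | ys , t , uniq with DecMembership._∈?_ _≟_ x (y ∷ ys)
  ...   | yes x∈ = suffix x∈ t uniq
  ...   | no  x∉ = y ∷ ys , step r t , ¬Any⇒All¬ (y ∷ ys) x∉ ∷ uniq

  prefix : ∀ {P : Pred V 0ℓ} {x y z ys} → x ∈ y ∷ ys → Trail R y ys z →
           All P (y ∷ ys) → Star (λ a b → P a × P b × R a b) y x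
  prefix (here refl) _          _             = ε
  prefix (there x∈)  (step r t) (py ∷ pz ∷ ps) = (py , pz , r) ◅ prefix x∈ t (pz ∷ ps)

  trail-step : ∀ {x z xs} → Trail R x xs z →
               ∀ i → R (lookup (x ∷ xs) (inject₁ i)) (lookup (x ∷ xs) (suc i))
  trail-step (step r _) zero    = r
  trail-step (step _ t) (suc i) = trail-step t i

  trail-end : ∀ {x z xs} → Trail R x xs z → lookup (x ∷ xs) (fromℕ (length xs)) ≡ z
  trail-end stop       = refl
  trail-end (step _ t) = trail-end t

lookup-injective : ∀ {V : Set} {xs : List V} → Unique xs → Injective _≡_ _≡_ (lookup xs)
lookup-injective (_ ∷ _) {zero}  {zero}  _ = refl
lookup-injective (d ∷ _) {zero}  {suc j} e = ⊥-elim (All.lookup d (∈-lookup j) e)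
lookup-injective (d ∷ _) {suc i} {zero}  e = ⊥-elim (All.lookup d (∈-lookup i) (sym e))
lookup-injective (_ ∷ uniq) {suc i} {suc j} e = cong suc (lookup-injective uniq e)

module _ (H : Graph) where
  open Graph H

  vertexAt-index : ∀ x → vertexAt (index x) ≡ x
  vertexAt-index = Inverse.strictlyInverseʳ finite

  index-injective : Injective _≡_ _≡_ index
  index-injective {x} {y} e =
    trans (sym (vertexAt-index x)) (trans (cong vertexAt e) (vertexAt-index y))

  _≟ⱽ_ : DecidableEquality Vertex
  x ≟ⱽ y = map′ index-injective (cong index) (index x ≟ᶠ index y)

  unique⇒length≤order : ∀ {xs} → Unique xs → length xs ≤ order
  unique⇒length≤order {xs} uniq =
    injective⇒≤ {f = index ∘ lookup xs} (lookup-injective uniq ∘ index-injective)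

  -- Loop erasure turns the bypass into a simple path. It has at least two edges, since `x` and `y`
  -- differ and the single step from `x` to `y` is excluded, so the edge closes it to a cycle.
  bypass⇒cycle : ∀ {x y} → x ~ y →
                 Star (λ a b → a ~ b × ¬ (a ≡ x × b ≡ y)) x y → Cycle H
  bypass⇒cycle {x} x~y w with loop-erase _≟ⱽ_ w
  ... | []          , stop              , _ = ⊥-elim (~-irrefl refl x~y)
  ... | _ ∷ []      , step (_ , bad) stop , _ = ⊥-elim (bad (refl , refl))
  ... | a ∷ b ∷ xs , t                  , uniq = record
    { extra    = length xs
    ; at       = lookup (x ∷ a ∷ b ∷ xs)
    ; distinct = lookup-injective uniq
    ; adjacent = λ i → proj₁ (trail-step t i)
    ; closing  = subst (_~ x) (sym (trail-end t)) (~-sym x~y)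
    }

-- The Helly property of subtrees

-- If no vertex t lies in every P i, pick for each t a missed P i and step from t
-- towards it.  Iterating this never turns back along an edge st: the sets missed
-- at s and at t meet in some z, which could be reached from t avoiding s and from
-- s avoiding t, bypassing the edge.  A walk that never turns back closes a cycle.
module Helly (T : Graph) (isTree : IsTree T) {n : ℕ}
  (P : Fin n → Pred (Graph.Vertex T) 0ℓ) (P? : ∀ i → Decidable (P i))
  (P-connected : ∀ i → ConnectedOn T (P i))
  (P-meet : ∀ i j → ∃[ t ] P i t × P j t)
  where

  open Graph T
  open IsTree isTree

  Avoiding : Vertex → Rel Vertex 0ℓ
  Avoiding t a b = a ≢ t × b ≢ t × a ~ b

  -- Cuts the walk just after its last visit to `t`; the left alternative is a walk that never
  -- visits `t`.
  last-exit : ∀ t {x s} → Star _~_ x s → s ≢ t →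
              (x ≢ t × Star (Avoiding t) x s) ⊎ (∃[ y ] t ~ y × Star (Avoiding t) y s)
  last-exit t ε s≢t = inj₁ (s≢t , ε)
  last-exit t {x} (x~y ◅ w) s≢t with last-exit t w s≢t
  ... | inj₂ exit = inj₂ exit
  ... | inj₁ (y≢t , w′) with _≟ⱽ_ T x t
  ...   | yes refl = inj₂ (_ , x~y , w′)
  ...   | no  x≢t  = inj₁ (x≢t , (x≢t , y≢t , x~y) ◅ w′)

  module Escape (missed : ∀ t → ∃[ i ] ¬ P i t) where

    miss : Vertex → Fin n
    miss t = proj₁ (missed t)

    -- The neighbour is the one used after the last visit to `t` on a walk from `t` to a point of
    -- the missed set. That set is connected and avoids `t`, so all of it is reached from there.
    exit : ∀ t → ∃[ y ] t ~ y × (∀ z → P (miss t) z → Star (Avoiding t) y z)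
    exit t with missed t
    ... | i , ¬Pit with P-meet i i
    ...   | s , Pis , _ with last-exit t (connected t s) (λ { refl → ¬Pit Pis })
    ...     | inj₁ (t≢t , _)      = ⊥-elim (t≢t refl)
    ...     | inj₂ (y , t~y , w) =
      y , t~y , λ z Piz → w ◅◅ Star.map stay (P-connected i Pis Piz)
      where
      stay : ∀ {a b} → P i a × P i b × a ~ b → Avoiding t a b
      stay (Pa , Pb , a~b) = (λ { refl → ¬Pit Pa }) , (λ { refl → ¬Pit Pb }) , a~b

    next : Vertex → Vertex
    next t = proj₁ (exit t)

    ~-next : ∀ t → t ~ next t
    ~-next t = proj₁ (proj₂ (exit t))

    reach : ∀ t z → P (miss t) z → Star (Avoiding t) (next t) z
    reach t = proj₂ (proj₂ (exit t))

    Avoiding-sym : ∀ {t a b} → Avoiding t a b → Avoiding t b a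
    Avoiding-sym (a≢t , b≢t , a~b) = b≢t , a≢t , ~-sym a~b

    no-return : ∀ t → next (next t) ≢ t
    no-return t back with P-meet (miss t) (miss (next t))
    ... | z , Pz , Pz′ = acyclic (bypass⇒cycle T (~-sym (~-next t)) (there-way ◅◅ back-way))
      where
      R : Rel Vertex 0ℓ
      R a b = a ~ b × ¬ (a ≡ next t × b ≡ t)

      there-way : Star R (next t) z
      there-way = Star.map (λ (_ , b≢t , a~b) → a~b , b≢t ∘ proj₂) (reach t z Pz)

      back-way : Star R z t
      back-way = Star.map (λ (a≢n , _ , a~b) → a~b , a≢n ∘ proj₁)
        (Star.reverse Avoiding-sym
          (subst (λ y → Star (Avoiding (next t)) y z) back (reach (next t) z Pz′)))

    -- The trail stores the walk backwards, latest vertex first. All visited vertices are distinct,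
    -- so `order` bounds the number of extensions.
    walk-forever : ∀ fuel {x z xs} → Trail _~_ x xs z → Unique (next x ∷ x ∷ xs) →
                   order ≤ fuel + length xs → ⊥
    walk-forever fuel {x} {xs = xs} t uniq@(fresh ∷ _) bound
      with DecMembership._∈?_ (_≟ⱽ_ T) (next (next x)) (next x ∷ x ∷ xs)
    ... | yes (here e) = ~-irrefl (sym e) (~-next (next x))
    -- The edge from `next x` to an earlier vertex is bypassed by stepping back to `x` and following
    -- the old trail, which never meets `next x`.
    ... | yes (there n∈) = acyclic (bypass⇒cycle T (~-next (next x))
            ((~-sym (~-next x) , λ (_ , e) → no-return x (sym e)) ◅
             Star.map (λ (a≢ , _ , a~b) → a~b , λ (e , _) → a≢ (sym e)) (prefix n∈ t fresh)))
    walk-forever zero       t uniq bound | no n∉ =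
      1+n≰n (≤-trans (m≤n⇒m≤1+n (n≤1+n _))
        (≤-trans (unique⇒length≤order T (¬Any⇒All¬ _ n∉ ∷ uniq)) bound))
    walk-forever (suc fuel) t uniq bound | no n∉ =
      walk-forever fuel (step (~-sym (~-next _)) t) (¬Any⇒All¬ _ n∉ ∷ uniq)
        (subst (order ≤_) (sym (+-suc fuel _)) bound)

    impossible : ⊥
    impossible = walk-forever order stop
      (((λ e → ~-irrefl (sym e) (~-next nonempty)) ∷ []) ∷ [] ∷ []) (m≤m+n order 0)

  helly : ∃[ t ] ∀ i → P i t
  helly with any? (λ f → all? (λ i → P? i (vertexAt f)))
  ... | yes (f , all) = vertexAt f , all
  ... | no  none      = ⊥-elim (Escape.impossible missed)
    where
    missed : ∀ t → ∃[ i ] ¬ P i t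
    missed t = ¬∀⟶∃¬ n (λ i → P i t) (λ i → P? i t)
      (λ all → none (index t , subst (λ s → ∀ i → P i s) (sym (vertexAt-index T t)) all))

-- Clique minors bound the width from below

injection⇒≤∣_∣ : ∀ {m n} (S : Subset n) {f : Fin m → Fin n} → Injective _≡_ _≡_ f →
                 (∀ i → f i ∈ˢ S) → m ≤ ∣ S ∣
injection⇒≤∣_∣ {zero}  S         inj f∈S = z≤n
injection⇒≤∣_∣ {suc m} S {f = f} inj f∈S =
  ≤-trans (s≤s (injection⇒≤∣ S ∖ f zero ∣ (suc-injectiveᶠ ∘ inj)
                  (λ i → x∈p∧x≢y⇒x∈p-y (f∈S (suc i)) (λ e → contradiction (inj e) λ ()))))
          (x∈p⇒∣p-x∣<∣p∣ (f∈S zero))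

module _ {H : Graph} (D : TreeDecomposition H) where
  open Graph H
  open TreeDecomposition D
  private module T = Graph tree

  ∣bag∣≤max : ∀ t → ∣ bag t ∣ ≤ max 0 (tabulate (λ i → ∣ bag (T.vertexAt i) ∣))
  ∣bag∣≤max t = subst (λ s → ∣ bag s ∣ ≤ _) (vertexAt-index tree t)
    (tabulate⁻ (xs≤max 0 (tabulate (λ i → ∣ bag (T.vertexAt i) ∣))) (T.index t))

module CliqueMinor (H : Graph) {n : ℕ}
  (B : Fin n → Pred (Graph.Vertex H) 0ℓ) (B? : ∀ i → Decidable (B i))
  (B-nonempty : ∀ i → ∃[ x ] B i x)
  (B-connected : ∀ i → ConnectedOn H (B i))
  (B-disjoint : ∀ {i j x} → B i x → B j x → i ≡ j)
  (B-adjacent : ∀ {i j} → toℕ i < toℕ j → ∃[ x ] ∃[ y ] B i x × B j y × Graph._~_ H x y)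
  where

  open Graph H

  module _ (D : TreeDecomposition H) where
    open TreeDecomposition D
    private module T = Graph tree

    Hits : Fin n → Pred T.Vertex 0ℓ
    Hits i t = ∃[ x ] B i x × x ∈bag t

    hits? : ∀ i → Decidable (Hits i)
    hits? i t = map′
      (λ (f , Bf , f∈) → vertexAt f , Bf , f∈)
      (λ (x , Bx , x∈) → index x ,
        subst (λ y → B i y × y ∈bag t) (sym (vertexAt-index H x)) (Bx , x∈))
      (any? (λ f → B? i (vertexAt f) ×-dec (index (vertexAt f) ∈ˢ? bag t)))

    HitsStep : Fin n → Rel T.Vertex 0ℓ
    HitsStep i a b = Hits i a × Hits i b × a T.~ b

    within-bags : ∀ {i x s t} → B i x → x ∈bag s → x ∈bag t → Star (HitsStep i) s t
    within-bags {x = x} Bx x∈s x∈t = Star.map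
      (λ (x∈a , x∈b , a~b) → (x , Bx , x∈a) , (x , Bx , x∈b) , a~b) (coherent x x∈s x∈t)

    -- Follow a walk inside the branch set: adjacent vertices share a bag, and the bags of a single
    -- vertex are connected by `coherent`.
    hits-connected : ∀ i → ConnectedOn tree (Hits i)
    hits-connected i (x , Bx , x∈s) (y , By , y∈t) = along (B-connected i Bx By) Bx x∈s y∈t
      where
      along : ∀ {x y s t} → Star (λ a b → B i a × B i b × a ~ b) x y →
              B i x → x ∈bag s → y ∈bag t → Star (HitsStep i) s t
      along ε Bx x∈s x∈t = within-bags Bx x∈s x∈t
      along ((Bx , By , x~y) ◅ w) _ x∈s z∈t with coversEdges x~y
      ... | r , x∈r , y∈r = within-bags Bx x∈s x∈r ◅◅ along w By y∈r z∈t

    hits-meet : ∀ i j → ∃[ t ] Hits i t × Hits j t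
    hits-meet i j with <-cmp (toℕ i) (toℕ j)
    hits-meet i j | tri< i<j _ _ with B-adjacent i<j
    ... | x , y , Bx , By , x~y with coversEdges x~y
    ...   | t , x∈t , y∈t = t , (x , Bx , x∈t) , (y , By , y∈t)
    hits-meet i j | tri> _ _ j<i with B-adjacent j<i
    ... | x , y , Bx , By , x~y with coversEdges x~y
    ...   | t , x∈t , y∈t = t , (y , By , y∈t) , (x , Bx , x∈t)
    hits-meet i j | tri≈ _ i≡j _ with toℕ-injective i≡j | B-nonempty i
    ... | refl | x , Bx with coversVertices x
    ...   | t , x∈t = t , (x , Bx , x∈t) , (x , Bx , x∈t)

    -- Some bag meets all `n` branch sets, and disjointness makes the chosen vertices distinct.
    width≥ : n ∸ 1 ≤ width
    width≥ with Helly.helly tree isTree Hits hits? hits-connected hits-meet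
    ... | t , hit = ∸-monoˡ-≤ 1 (≤-trans
      (injection⇒≤∣ bag t ∣ {f = λ i → index (proj₁ (hit i))} representative-injective
        (λ i → proj₂ (proj₂ (hit i))))
      (∣bag∣≤max D t))
      where
      representative-injective : Injective _≡_ _≡_ (λ i → index (proj₁ (hit i)))
      representative-injective {i} {j} e = B-disjoint
        (subst (B i) (index-injective H e) (proj₁ (proj₂ (hit i)))) (proj₁ (proj₂ (hit j)))

-- Stepping around a cycle

-- The cyclic successor merges `adjacent` and `closing` into the single fact `at-next`.
next : ∀ {n} → Fin (suc n) → Fin (suc n)
next i with view i
... | ‵fromℕ     = zero
... | ‵inject₁ j = suc j

toℕ-next : ∀ {n} (i : Fin (suc n)) →
           toℕ (next i) ≡ suc (toℕ i) ⊎ toℕ i ≡ n × toℕ (next i) ≡ 0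
toℕ-next {n} i with view i
... | ‵fromℕ     = inj₂ (toℕ-fromℕ n , refl)
... | ‵inject₁ j = inj₁ (cong suc (sym (toℕ-inject₁ j)))

-- With at least three positions, two steps around cannot return to the start; hence a cycle never
-- turns straight back.
next²-≢ : ∀ {n} (i : Fin (3 + n)) → next (next i) ≢ i
next²-≢ i e with toℕ-next i | toℕ-next (next i)
... | inj₁ p       | inj₁ q       = m≢1+n+m (toℕ i) {1}
  (trans (cong toℕ (sym e)) (trans q (cong suc p)))
... | inj₁ p       | inj₂ (q , r) = 1+n≢0 (suc-injective
  (trans (sym q) (trans p (cong suc (trans (cong toℕ (sym e)) r)))))
... | inj₂ (p , r) | inj₁ q       = 1+n≢0 (suc-injective
  (trans (sym p) (trans (cong toℕ (sym e)) (trans q (cong suc r)))))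
... | inj₂ (p , r) | inj₂ (q , _) = 1+n≢0 (trans (sym q) r)

module _ {H : Graph} (C : Cycle H) where
  open Graph H
  open Cycle C

  at-next : ∀ i → at i ~ at (next i)
  at-next i with view i
  ... | ‵fromℕ     = closing
  ... | ‵inject₁ j = adjacent j

  at-next² : ∀ i → at (next (next i)) ≢ at i
  at-next² i = next²-≢ i ∘ distinct



-- The path and 2-adic valuations

Consecutive : ℕ → ℕ → Set
Consecutive m n = n ≡ suc m ⊎ m ≡ suc n

data Direction : Set where
  up down : Direction

-- `n` lies at distance `t` from `m` in the given direction; addition on either side avoids
-- truncated subtraction.
Shift : Direction → ℕ → ℕ → ℕ → Set
Shift up   t m n = n ≡ t + m
Shift down t m n = m ≡ t + n

consecutive⇒shift : ∀ {m n} → Consecutive m n → ∃[ d ] Shift d 1 m n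
consecutive⇒shift (inj₁ e) = up , e
consecutive⇒shift (inj₂ e) = down , e

-- A step from `n′` goes either onwards or back to `n`, and the latter is excluded.
shift-on : ∀ d {t m n n′ n″} → Shift d t m n → Shift d (suc t) m n′ →
           Consecutive n′ n″ → n″ ≢ n → Shift d (2 + t) m n″
shift-on up   refl refl (inj₁ e) _ = e
shift-on up   refl refl (inj₂ e) n″≢n = ⊥-elim (n″≢n (sym (suc-injective e)))
shift-on down {t} {m} {n} {n′} s s′ (inj₁ e) n″≢n =
  ⊥-elim (n″≢n (trans e (+-cancelˡ-≡ t _ _ (trans (+-suc t n′) (trans (sym s′) s)))))
shift-on down {t} {n″ = n″} _ refl (inj₂ refl) _ = cong suc (+-suc t n″)

2^-mono-∣ : ∀ {a b} → a ≤ b → 2 ^ a ∣ 2 ^ b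
2^-mono-∣ {a} a≤b with m≤n⇒∃[o]m+o≡n a≤b
... | o , refl = subst (2 ^ a ∣_) (sym (^-distribˡ-+-* 2 a o)) (m∣m*n (2 ^ o))

largestPower-unique : ∀ {i j n} → IsLargestPower i n → IsLargestPower j n → i ≡ j
largestPower-unique (i∣ , i-max) (j∣ , j-max) = ≤-antisym (j-max _ i∣) (i-max _ j∣)

shift-∣ : ∀ d {t m n c} → Shift d t m n → c ∣ m → c ∣ n → c ∣ t
shift-∣ up   {t} {c = c} refl c∣m c∣n = ∣m+n∣m⇒∣n (subst (c ∣_) (+-comm t _) c∣n) c∣m
shift-∣ down {t} {c = c} refl c∣m c∣n = ∣m+n∣m⇒∣n (subst (c ∣_) (+-comm t _) c∣m) c∣n

∣-shift : ∀ d {t m n c} → Shift d t m n → c ∣ m → c ∣ t → c ∣ n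
∣-shift up   refl c∣m c∣t = ∣m∣n⇒∣m+n c∣t c∣m
∣-shift down refl c∣m c∣t = ∣m+n∣m⇒∣n c∣m c∣t

-- If `b ≤ c`, then `2 ^ b` divides both ends and hence their distance `t`, impossible for
-- `0 < t < 2 ^ b`.
largestPower-near : ∀ d {t m n a b c} → Shift d t m n → 2 ^ a ∣ m → b ≤ a →
                    1 ≤ t → t < 2 ^ b → IsLargestPower c n → c < b
largestPower-near d {suc t} s a∣m b≤a _ t<2^b (c∣n , _) = ≰⇒> λ b≤c →
  <⇒≱ t<2^b (∣⇒≤ (shift-∣ d s (∣-trans (2^-mono-∣ b≤a) a∣m) (∣-trans (2^-mono-∣ b≤c) c∣n)))

-- `2 ^ b` divides both `m` and the distance. A higher power dividing `n` would make `2 ^ suc b`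
-- divide the distance `2 ^ b`.
largestPower-shift : ∀ d {m n a b} → Shift d (2 ^ b) m n → 2 ^ a ∣ m → b < a →
                     IsLargestPower b n
largestPower-shift d {b = b} s a∣m b<a =
  ∣-shift d s (∣-trans (2^-mono-∣ (<⇒≤ b<a)) a∣m) ∣-refl ,
  λ c c∣n → ≮⇒≥ λ b<c →
    <⇒≱ (^-monoʳ-< 2 (s≤s z<s) (n<1+n b))
        (∣⇒≤ {{m^n≢0 2 b}} (shift-∣ d s (∣-trans (2^-mono-∣ b<a) a∣m) (∣-trans (2^-mono-∣ b<c) c∣n)))

-- Independent cycles are impossible

module _ {k : ℕ} where

  pos-injective : ∀ {p q : Fin (2 ^ k ∸ 1)} → pos k p ≡ pos k q → p ≡ q
  pos-injective = toℕ-injective ∘ suc-injective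

  pos<2^k : ∀ p → pos k p < 2 ^ k
  pos<2^k p = ≤-trans (s≤s (toℕ<n p)) (≤-reflexive (suc-pred (2 ^ k) {{m^n≢0 2 k}}))

  module _ (C : Cycle (G k)) where
    open Cycle C

    -- While on the path, a cycle cannot turn back and so moves away from u p.
    leaves-path : ∀ D p {i j q} → at i ≡ u p → at j ≡ u q → next i ≡ j →
                  (∀ d i r → at i ≡ u r → ¬ Shift d D (pos k p) (pos k r)) → 1 ≤ D →
                  ∃[ d ] ∃[ t ] ∃[ r ] ∃[ l ] ∃[ c ]
                    1 ≤ t × t < D × Shift d t (pos k p) (pos k r) ×
                    at l ≡ v c × IsLargestPower (toℕ c) (pos k r)
    leaves-path D p {i} {j} {q} ei ej refl blocked 1≤D
      with consecutive⇒shift (subst₂ (GkAdj k) ei ej (at-next C i))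
    ... | d , s = run (D ∸ 1) 0 i p q ei ej (m∸n+n≡m 1≤D) (base d) s
      where
      base : ∀ d → Shift d 0 (pos k p) (pos k p)
      base up   = refl
      base down = refl

      -- The current and next vertices lie at distances `t` and `suc t` from `u p`. The fuel
      -- equation makes exhaustion coincide with reaching the blocked distance `D`.
      run : ∀ fuel t i p′ q → at i ≡ u p′ → at (next i) ≡ u q → fuel + suc t ≡ D →
            Shift d t (pos k p) (pos k p′) → Shift d (suc t) (pos k p) (pos k q) →
            ∃[ d ] ∃[ t ] ∃[ r ] ∃[ l ] ∃[ c ]
              1 ≤ t × t < D × Shift d t (pos k p) (pos k r) ×
              at l ≡ v c × IsLargestPower (toℕ c) (pos k r)
      run zero t i p′ q ei en refl s s′ = ⊥-elim (blocked d (next i) q en s′)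
      run (suc fuel) t i p′ q ei en eq s s′ with at (next (next i)) in e | at-next C (next i)
      ... | v c | adj = d , suc t , q , next (next i) , c , s≤s z≤n ,
              subst (suc t <_) eq (s≤s (m≤n+m (suc t) fuel)) , s′ , e ,
              subst (λ x → GkAdj k x (v c)) en adj
      ... | u r | adj = run fuel (suc t) (next i) q r en e (trans (+-suc fuel (suc t)) eq) s′
              (shift-on d s s′ (subst (λ x → GkAdj k x (u r)) en adj)
                (λ r≡p′ → at-next² C i (trans e (trans (cong inj₁ (pos-injective r≡p′)) (sym ei)))))

    -- No two path vertices are `2 ^ k` apart, so that radius is blocked and a cycle on the path
    -- must leave it.
    meets-apex : ∃[ i ] ∃[ c ] at i ≡ v c
    meets-apex with at zero in e₀ | at (next zero) in e₁
    ... | v c | _   = zero , c , e₀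
    ... | u _ | v c = next zero , c , e₁
    ... | u p | u q with leaves-path (2 ^ k) p e₀ e₁ refl too-far (m^n>0 2 k)
      where
      too-far : ∀ d i r → at i ≡ u r → ¬ Shift d (2 ^ k) (pos k p) (pos k r)
      too-far up   i r _ s = <⇒≱ (pos<2^k r) (subst (2 ^ k ≤_) (sym s) (m≤m+n (2 ^ k) _))
      too-far down i r _ s = <⇒≱ (pos<2^k p) (subst (2 ^ k ≤_) (sym s) (m≤m+n (2 ^ k) _))
    ...   | _ , _ , _ , l , c , _ , _ , _ , e , _ = l , c , e

  -- From v a until it next leaves the path, C stays within distance 2^b of its entry
  -- point, since the path vertices at distance exactly 2^b are adjacent to v b.
  lower-apex : ∀ {C D : Cycle (G k)} → Independent (G k) C D →
               ∀ {i j a b} → Cycle.at C i ≡ v a → Cycle.at D j ≡ v b → toℕ b < toℕ a →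
               ∃[ l ] ∃[ c ] Cycle.at C l ≡ v c × toℕ c < toℕ b
  lower-apex {C} {D} ind {i} {j} {a} {b} eC eD b<a
    with Cycle.at C (next i) in e₁ | at-next C i
  ... | v _ | adj = ⊥-elim (subst (λ x → GkAdj k x _) eC adj)
  ... | u p | adj with Cycle.at C (next (next i)) in e₂ | at-next C (next i)
  -- `u p` has only one apex neighbour, so `c` would equal `a` and the cycle would turn straight
  -- back.
  ...   | v c | adj′ = ⊥-elim (at-next² C i (trans e₂ (trans (cong inj₂ (toℕ-injective
            (largestPower-unique (subst (λ x → GkAdj k x _) e₁ adj′)
              (subst (λ x → GkAdj k x _) eC adj)))) (sym eC))))
  ...   | u q | _ with leaves-path C (2 ^ toℕ b) p e₁ e₂ refl blocked (m^n>0 2 (toℕ b))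
    where
    a∣p : 2 ^ toℕ a ∣ pos k p
    a∣p = proj₁ (subst (λ x → GkAdj k x (u p)) eC adj)

    blocked : ∀ d l r → Cycle.at C l ≡ u r → ¬ Shift d (2 ^ toℕ b) (pos k p) (pos k r)
    blocked d l r e s = proj₂ (ind l j)
      (subst₂ (GkAdj k) (sym e) (sym eD) (largestPower-shift d s a∣p b<a))
  ...     | d , t , r , l , c , 1≤t , t<2^b , s , e , c-max =
    l , c , e , largestPower-near d s
      (proj₁ (subst (λ x → GkAdj k x (u p)) eC adj)) (<⇒≤ b<a) 1≤t t<2^b c-max

  Independent-sym : ∀ {C D : Cycle (G k)} → Independent (G k) C D → Independent (G k) D C
  Independent-sym {C} {D} ind i j =
    proj₁ (ind j i) ∘ sym , proj₂ (ind j i) ∘ Graph.~-sym (G k) {Cycle.at D i} {Cycle.at C j}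

  no-descent : ∀ {C D : Cycle (G k)} → Independent (G k) C D →
               ∀ {i j a b} → Cycle.at C i ≡ v a → Cycle.at D j ≡ v b → toℕ b < toℕ a →
               Acc _<_ (toℕ b) → ⊥
  no-descent {C} {D} ind eC eD b<a (acc rec) with lower-apex {C} {D} ind eC eD b<a
  ... | l , c , e , c<b = no-descent {D} {C} (Independent-sym {C} {D} ind) eD e c<b (rec c<b)

  O₂-free : O₂-Free (G k)
  O₂-free (C , D , ind) with meets-apex C | meets-apex D
  ... | i , a , eC | j , b , eD with <-cmp (toℕ a) (toℕ b)
  ...   | tri< a<b _ _ = no-descent {D} {C} (Independent-sym {C} {D} ind) eD eC a<b (<-wellFounded _)
  ...   | tri> _ _ b<a = no-descent {C} {D} ind eC eD b<a (<-wellFounded _)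
  ...   | tri≈ _ a≡b _ = proj₁ (ind i j) (trans eC (trans (cong inj₂ (toℕ-injective a≡b)) (sym eD)))

-- Excluding `K₃,₃`

module _ {k : ℕ} where

  path-degree≤2 : ∀ {p : Fin (2 ^ k ∸ 1)} {l : Fin 3 → Fin (2 ^ k ∸ 1)} → Injective _≡_ _≡_ l →
                  ¬ (∀ i → Consecutive (pos k p) (pos k (l i)))
  path-degree≤2 {p} {l} l-inj adj = go (adj 0F) (adj 1F) (adj 2F)
    where
    clash : ∀ {i j} → i ≢ j → pos k (l i) ≢ pos k (l j)
    clash i≢j = i≢j ∘ l-inj ∘ pos-injective {k}

    go : Consecutive (pos k p) (pos k (l 0F)) → Consecutive (pos k p) (pos k (l 1F)) →
         Consecutive (pos k p) (pos k (l 2F)) → ⊥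
    go (inj₁ a) (inj₁ b) _        = clash {0F} {1F} (λ ()) (trans a (sym b))
    go (inj₁ a) (inj₂ b) (inj₁ c) = clash {0F} {2F} (λ ()) (trans a (sym c))
    go (inj₁ a) (inj₂ b) (inj₂ c) = clash {1F} {2F} (λ ()) (suc-injective (trans (sym b) c))
    go (inj₂ a) (inj₂ b) _        = clash {0F} {1F} (λ ()) (suc-injective (trans (sym a) b))
    go (inj₂ a) (inj₁ b) (inj₂ c) = clash {0F} {2F} (λ ()) (suc-injective (trans (sym a) c))
    go (inj₂ a) (inj₁ b) (inj₁ c) = clash {1F} {2F} (λ ()) (trans b (sym c))

  OnPath : Pred (GkVertex k) 0ℓ
  OnPath x = ∃[ p ] x ≡ u p

  module _ {x y : Fin 3 → GkVertex k} (x-inj : Injective _≡_ _≡_ x)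
           (adj : ∀ i j → GkAdj k (x i) (y j)) where

    apex⇒onPath : ∀ {j b} → y j ≡ v b → ∀ i → OnPath (x i)
    apex⇒onPath {j} e i with x i | adj i j
    ... | u p | _ = p , refl
    ... | v a | a~yj = ⊥-elim (subst (GkAdj k (v a)) e a~yj)

    -- If `x 0F` and `x 1F` were both apexes, their common neighbour `y 0F` would be a path vertex
    -- with two apex neighbours.
    some-onPath : ∃[ i ] OnPath (x i)
    some-onPath with x 0F in e₀ | x 1F in e₁ | y 0F | adj 0F 0F | adj 1F 0F
    ... | u p | _   | _   | _  | _  = 0F , p , e₀
    ... | v _ | u p | _   | _  | _  = 1F , p , e₁
    ... | v a | v b | u q | α  | β
      with () ← x-inj {0F} {1F} (trans e₀
                  (trans (cong inj₂ (toℕ-injective (largestPower-unique α β))) (sym e₁)))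

  claw-free : ∀ {x : GkVertex k} {y : Fin 3 → GkVertex k} → OnPath x → Injective _≡_ _≡_ y →
              (∀ j → OnPath (y j)) → ¬ (∀ j → GkAdj k x (y j))
  claw-free {y = y} (p , refl) y-inj on adj = path-degree≤2 {p} {proj₁ ∘ on}
    (λ {i} {j} e → y-inj (trans (proj₂ (on i)) (trans (cong inj₁ e) (sym (proj₂ (on j))))))
    (λ j → subst (GkAdj k (u p)) (proj₂ (on j)) (adj j))

  -- One side lies wholly on the path: the left one if the right contains an apex, otherwise the
  -- right one. A path vertex of the opposite side then has three path neighbours.
  K₃₃-free : ¬ (completeBipartite 3 3 ⊑ G k)
  K₃₃-free (f , f-inj , hom) with any? (λ j → apex? (f (inj₂ j)))
    where
    apex? : ∀ x → Dec (∃[ c ] x ≡ v c)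
    apex? (u p) = no λ ()
    apex? (v c) = yes (c , refl)
  ... | yes (j , b , e) =
    let l , on = some-onPath {f ∘ inj₂} {f ∘ inj₁} r-inj (λ i j → hom _)
    in claw-free on l-inj (apex⇒onPath {f ∘ inj₁} {f ∘ inj₂} l-inj (λ i j → hom _) e) (λ j → hom _)
    where
    l-inj : Injective _≡_ _≡_ (f ∘ inj₁)
    l-inj e with refl ← f-inj e = refl
    r-inj : Injective _≡_ _≡_ (f ∘ inj₂)
    r-inj e with refl ← f-inj e = refl
  ... | no none =
    let l , on = some-onPath {f ∘ inj₁} {f ∘ inj₂} l-inj (λ i j → hom _)
    in claw-free on r-inj (λ j → on-path (f (inj₂ j)) (λ c e → none (j , c , e))) (λ j → hom _)
    where
    l-inj : Injective _≡_ _≡_ (f ∘ inj₁)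
    l-inj e with refl ← f-inj e = refl
    r-inj : Injective _≡_ _≡_ (f ∘ inj₂)
    r-inj e with refl ← f-inj e = refl
    on-path : ∀ x → (∀ c → x ≢ v c) → OnPath x
    on-path (u p) _  = p , refl
    on-path (v c) ¬v = ⊥-elim (¬v c refl)

-- Segments of the path

Convex : ∀ {n} → Pred (Fin n) 0ℓ → Set
Convex P = ∀ {p q r} → P p → P r → toℕ p ≤ toℕ q → toℕ q ≤ toℕ r → P q

-- The general `R` and `f` let one argument serve branch sets, path graphs and the coherence of
-- bags.
convex⇒star : ∀ {n} {A : Set} {R : Rel A 0ℓ} → Symmetric R →
              (f : Fin n → A) {P : Pred (Fin n) 0ℓ} → Convex P →
              (∀ {p q} → P p → P q → toℕ q ≡ suc (toℕ p) → R (f p) (f q)) →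
              ∀ {p q} → P p → P q → Star R (f p) (f q)
convex⇒star {n} {R = R} R-sym f {P} convex adj {p} {q} Pp Pq =
  [ (λ p≤q → ascend (toℕ q ∸ toℕ p) Pp Pq (m∸n+n≡m p≤q))
  , (λ q≤p → Star.reverse R-sym (ascend (toℕ p ∸ toℕ q) Pq Pp (m∸n+n≡m q≤p)))
  ]′ (≤-total (toℕ p) (toℕ q))
  where
  ascend : ∀ t {p q} → P p → P q → t + toℕ p ≡ toℕ q → Star R (f p) (f q)
  ascend zero    _ _ e with refl ← toℕ-injective e = ε
  ascend (suc t) {p} {q} Pp Pq e =
    adj Pp Pp′ p′≡ ◅ ascend t Pp′ Pq (trans (cong (t +_) p′≡) (trans (+-suc t (toℕ p)) e))
    where
    p<q : toℕ p < toℕ q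
    p<q = subst (toℕ p <_) e (s≤s (m≤n+m (toℕ p) t))
    p<n : suc (toℕ p) < n
    p<n = ≤-<-trans p<q (toℕ<n q)
    p′≡ : toℕ (fromℕ< p<n) ≡ suc (toℕ p)
    p′≡ = toℕ-fromℕ< p<n
    Pp′ : P (fromℕ< p<n)
    Pp′ = convex Pp Pq (subst (toℕ p ≤_) (sym p′≡) (n≤1+n _)) (subst (_≤ toℕ q) (sym p′≡) p<q)

module _ {k : ℕ} where

  path-vertex : ∀ {n} → 1 ≤ n → n < 2 ^ k → ∃[ p ] pos k p ≡ n
  path-vertex {suc n} _ n<2^k = fromℕ< n<N , cong suc (toℕ-fromℕ< n<N)
    where
    n<N : n < 2 ^ k ∸ 1
    n<N = ∸-monoˡ-≤ 1 n<2^k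

  onto : ∀ {n} {P : Pred ℕ 0ℓ} → 1 ≤ n → n < 2 ^ k → P n → ∃[ p ] P (pos k p)
  onto {P = P} 1≤n n<2^k Pn with path-vertex 1≤n n<2^k
  ... | p , refl = p , Pn

-- The clique minor with k + 1 branch sets

-- Branch set j + 1 occupies the path segment (start j, 2^(j+1)]; start 0 = 0 puts
-- u_1, which no interval (2^j, 2^(j+1)] contains, into branch set 1.

start : ℕ → ℕ
start zero    = 0
start (suc j) = 2 ^ suc j

start≤ : ∀ j → start j ≤ 2 ^ j
start≤ zero    = z≤n
start≤ (suc j) = ≤-refl

2^n+m<2^1+n : ∀ {n m} → m < 2 ^ n → 2 ^ n + m < 2 ^ suc n
2^n+m<2^1+n {n} {m} m<2^n =
  +-monoʳ-< (2 ^ n) (subst (m <_) (sym (+-identityʳ (2 ^ n))) m<2^n)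

1<2^1+n : ∀ n → 1 < 2 ^ suc n
1<2^1+n n = ^-monoʳ-< 2 (s≤s z<s) (z<s {n})

-- Strictness matters for the last segment: its right end `2 ^ k` is off the path, but its first
-- position is still on it.
1+start< : ∀ j → suc (start j) < 2 ^ suc j
1+start< zero    = s≤s (s≤s z≤n)
1+start< (suc j) = subst (_< 2 ^ (2 + j)) (+-comm (2 ^ suc j) 1) (2^n+m<2^1+n {suc j} (1<2^1+n j))

module Branches {k : ℕ} (1≤k : 1 ≤ k) where

  open Graph (G k) using (_~_; ~-sym)

  Branch : ℕ → Pred (GkVertex k) 0ℓ
  Branch zero    (u p) = ⊥
  Branch (suc j) (u p) = start j < pos k p × pos k p ≤ 2 ^ suc j
  Branch i       (v c) = toℕ c ≡ i

  branch? : ∀ i → Decidable (Branch i)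
  branch? zero    (u p) = no id
  branch? (suc j) (u p) = (start j <? pos k p) ×-dec (pos k p ≤? 2 ^ suc j)
  branch? zero    (v c) = toℕ c ≟ zero
  branch? (suc j) (v c) = toℕ c ≟ suc j

  ∈branch-v : ∀ i {c} → toℕ c ≡ i → Branch i (v c)
  ∈branch-v zero    e = e
  ∈branch-v (suc j) e = e

  branch-v : ∀ i {c} → Branch i (v c) → toℕ c ≡ i
  branch-v zero    e = e
  branch-v (suc j) e = e

  apex-in : ∀ {i} → i < k → ∃[ c ] Branch i (v c) × (∀ {p} → IsLargestPower i (pos k p) → v c ~ u p)
  apex-in {i} i<k = fromℕ< i<k , ∈branch-v i (toℕ-fromℕ< i<k) ,
    λ {p} → subst (λ c → IsLargestPower c (pos k p)) (sym (toℕ-fromℕ< i<k))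

  branch-nonempty : ∀ {i} → i ≤ k → ∃[ x ] Branch i x
  branch-nonempty {zero} _ with apex-in 1≤k
  ... | c , c∈ , _ = v c , c∈
  branch-nonempty {suc j} j<k
    with onto {k} {P = λ n → start j < n × n ≤ 2 ^ suc j} (s≤s z≤n)
           (<-≤-trans (1+start< j) (^-monoʳ-≤ 2 j<k)) (≤-refl , <⇒≤ (1+start< j))
  ... | p , p∈ = u p , p∈

  branch-disjoint : ∀ {i j x} → Branch i x → Branch j x → i ≡ j
  branch-disjoint {i}     {j}     {v c} a b = trans (sym (branch-v i a)) (branch-v j b)
  branch-disjoint {suc i} {suc j} {u p} (a , a′) (b , b′) with <-cmp i j
  ... | tri≈ _ refl _ = refl
  ... | tri< (s≤s i<j) _ _ = ⊥-elim (<⇒≱ b (≤-trans a′ (^-monoʳ-≤ 2 (s≤s i<j))))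
  ... | tri> _ _ (s≤s j<i) = ⊥-elim (<⇒≱ a (≤-trans b′ (^-monoʳ-≤ 2 (s≤s j<i))))

  Step : ℕ → Rel (GkVertex k) 0ℓ
  Step i a b = Branch i a × Branch i b × a ~ b

  Step-sym : ∀ {i} → Symmetric (Step i)
  Step-sym {i} {a} {b} (A , B , a~b) = B , A , ~-sym {a} {b} a~b

  -- Shift by `2 ^ n` from 0, which every power of two divides.
  largestPower-2^ : ∀ n → IsLargestPower n (2 ^ n)
  largestPower-2^ n = largestPower-shift up {m = 0} {a = suc n}
    (sym (+-identityʳ (2 ^ n))) ((2 ^ suc n) ∣0) (n<1+n n)

  -- The apex is adjacent to the right end `2 ^ suc j` of its segment, which is on the path because
  -- an apex index is below `k`.
  to-segment : ∀ j {x} → Branch (suc j) x → ∃[ p ] Branch (suc j) (u p) × Star (Step (suc j)) x (u p)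
  to-segment j {u p} p∈ = p , p∈ , ε
  to-segment j {v c} c∈
    with onto {k} {P = λ n → (start j < n × n ≤ 2 ^ suc j) × IsLargestPower (suc j) n}
           (m^n>0 2 (suc j)) (^-monoʳ-< 2 (s≤s z<s) (subst (_< k) c∈ (toℕ<n c)))
           ((<-trans (n<1+n _) (1+start< j) , ≤-refl) , largestPower-2^ (suc j))
  ... | p , p∈ , c~p = p , p∈ , (c∈ , p∈ , subst (λ i → IsLargestPower i (pos k p)) (sym c∈) c~p) ◅ ε

  branch-connected : ∀ i → ConnectedOn (G k) (Branch i)
  branch-connected zero {v a} {v b} a∈ b∈ with refl ← toℕ-injective (trans a∈ (sym b∈)) = ε
  branch-connected (suc j) x∈ y∈ with to-segment j x∈ | to-segment j y∈
  ... | p , p∈ , x⇝p | q , q∈ , y⇝q = x⇝p ◅◅ p⇝q ◅◅ Star.reverse Step-sym y⇝q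
    where
    p⇝q : Star (Step (suc j)) (u p) (u q)
    p⇝q = convex⇒star {R = Step (suc j)} Step-sym inj₁ {P = Branch (suc j) ∘ inj₁}
      (λ (a , _) (_ , b) p≤q q≤r → <-≤-trans a (s≤s p≤q) , ≤-trans (s≤s q≤r) b)
      (λ P Q e → P , Q , inj₁ (cong suc e)) p∈ q∈

  -- The neighbour is at position `start j + 2 ^ i`, whose valuation is `i` because `2 ^ suc i`
  -- divides `start j`.
  apex-adjacent : ∀ {i j} → i < k → j < k → 2 ^ suc i ∣ start j → start j + 2 ^ i < 2 ^ suc j →
                  ∃[ x ] ∃[ y ] Branch i x × Branch (suc j) y × x ~ y
  apex-adjacent {i} {j} i<k j<k i∣start fits with apex-in i<k
    | onto {k} {P = λ n → (start j < n × n ≤ 2 ^ suc j) × IsLargestPower i n}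
        (≤-trans (m^n>0 2 i) (m≤n+m (2 ^ i) (start j)))
        (<-≤-trans fits (^-monoʳ-≤ 2 j<k))
        ( (m<m+n (start j) (m^n>0 2 i) , <⇒≤ fits)
        , largestPower-shift up {a = suc i} (+-comm (start j) (2 ^ i)) i∣start (n<1+n i))
  ... | c , c∈ , adj | p , p∈ , i-max = v c , u p , c∈ , p∈ , adj i-max

  -- Non-consecutive sets are joined through the apex of the smaller index, and so are sets 0 and 1.
  -- Other consecutive sets are joined by the path edge between the end of one segment and the start
  -- of the next.
  branch-adjacent : ∀ {i j} → i < j → j ≤ k → ∃[ x ] ∃[ y ] Branch i x × Branch j y × x ~ y
  branch-adjacent {i} {suc j} (s≤s i≤j) j<k with m≤n⇒m<n∨m≡n i≤j
  branch-adjacent {i} {suc j@(suc _)} _ j<k | inj₁ i<j =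
    apex-adjacent (<-trans i<j j<k) j<k (2^-mono-∣ i<j) (2^n+m<2^1+n {j} (^-monoʳ-< 2 (s≤s z<s) i<j))
  branch-adjacent {_} {suc zero} _ j<k | inj₂ refl =
    apex-adjacent j<k j<k (2 ∣0) ≤-refl
  branch-adjacent {_} {suc j@(suc j′)} _ j<k | inj₂ refl
    with onto {k} {P = λ n → (start j′ < n × n ≤ 2 ^ j) × n ≡ 2 ^ j}
           (m^n>0 2 j) (^-monoʳ-< 2 (s≤s z<s) j<k)
           ((<-trans (n<1+n _) (1+start< j′) , ≤-refl) , refl)
       | onto {k} {P = λ n → (start j < n × n ≤ 2 ^ suc j) × n ≡ suc (2 ^ j)} (s≤s z≤n)
           (<-≤-trans (1+start< j) (^-monoʳ-≤ 2 j<k)) ((≤-refl , <⇒≤ (1+start< j)) , refl)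
  ... | p , p∈ , p≡ | q , q∈ , q≡ = u p , u q , p∈ , q∈ , inj₁ (trans q≡ (cong suc (sym p≡)))

treewidth≥ : ∀ {k} → 1 ≤ k → (D : TreeDecomposition (G k)) → k ≤ TreeDecomposition.width D
treewidth≥ {k} 1≤k = CliqueMinor.width≥ (G k) {suc k}
  (λ i → Branch (toℕ i)) (λ i → branch? (toℕ i))
  (λ i → branch-nonempty (toℕ≤pred[n] i)) (λ i → branch-connected (toℕ i))
  (λ a b → toℕ-injective (branch-disjoint a b))
  (λ {_} {j} i<j → branch-adjacent i<j (toℕ≤pred[n] j))
  where open Branches 1≤k

-- A path decomposition of width k

fromList : ∀ {n} → List (Fin n) → Subset n
fromList = foldr (λ x S → ⁅ x ⁆ ∪ S) ∅

∈-fromList⁺ : ∀ {n} {x : Fin n} {xs} → x ∈ xs → x ∈ˢ fromList xs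
∈-fromList⁺ (here refl) = x∈p∪q⁺ (inj₁ (x∈⁅x⁆ _))
∈-fromList⁺ {xs = y ∷ _} (there x∈) = x∈p∪q⁺ {p = ⁅ y ⁆} (inj₂ (∈-fromList⁺ x∈))

∈-fromList⁻ : ∀ {n} {x : Fin n} xs → x ∈ˢ fromList xs → x ∈ xs
∈-fromList⁻ []       x∈ = ⊥-elim (∉⊥ x∈)
∈-fromList⁻ (y ∷ xs) x∈ with x∈p∪q⁻ ⁅ y ⁆ (fromList xs) x∈
... | inj₁ x∈y  = here (x∈⁅y⁆⇒x≡y y x∈y)
... | inj₂ x∈xs = there (∈-fromList⁻ xs x∈xs)

∣⁅x⁆∪p∣≤1+∣p∣ : ∀ {n} (x : Fin n) p → ∣ ⁅ x ⁆ ∪ p ∣ ≤ suc ∣ p ∣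
∣⁅x⁆∪p∣≤1+∣p∣ zero    (inside  ∷ p) = s≤s (≤-trans (≤-reflexive (cong ∣_∣ (∪-identityˡ p))) (n≤1+n _))
∣⁅x⁆∪p∣≤1+∣p∣ zero    (outside ∷ p) = s≤s (≤-reflexive (cong ∣_∣ (∪-identityˡ p)))
∣⁅x⁆∪p∣≤1+∣p∣ (suc x) (inside  ∷ p) = s≤s (∣⁅x⁆∪p∣≤1+∣p∣ x p)
∣⁅x⁆∪p∣≤1+∣p∣ (suc x) (outside ∷ p) = ∣⁅x⁆∪p∣≤1+∣p∣ x p

∣fromList∣≤length : ∀ {n} (xs : List (Fin n)) → ∣ fromList xs ∣ ≤ length xs
∣fromList∣≤length {n} []   = ≤-reflexive (∣⊥∣≡0 n)
∣fromList∣≤length (x ∷ xs) = ≤-trans (∣⁅x⁆∪p∣≤1+∣p∣ x (fromList xs)) (s≤s (∣fromList∣≤length xs))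

pathGraph : ℕ → Graph
pathGraph n = record
  { Vertex   = Fin n
  ; order    = n
  ; finite   = ↔-id (Fin n)
  ; _~_      = λ p q → Consecutive (toℕ p) (toℕ q)
  ; _~?_     = λ p q → (toℕ q ≟ suc (toℕ p)) ⊎-dec (toℕ p ≟ suc (toℕ q))
  ; ~-sym    = swap
  ; ~-irrefl = λ { refl (inj₁ e) → 1+n≢n (sym e) ; refl (inj₂ e) → 1+n≢n (sym e) }
  }

-- Never turning back, a cycle would be at distance `n` from its start after `n` steps, which does
-- not fit in `Fin n`.
pathGraph-acyclic : ∀ {n} → ¬ Cycle (pathGraph n)
pathGraph-acyclic {n} C with consecutive⇒shift (at-next C zero)
  where open Cycle C
... | d , s = escape d (drift n)
  where
  open Cycle C
  p = toℕ (at zero)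

  base : ∀ d → Shift d 0 p p
  base up   = refl
  base down = refl

  drift : ∀ t → ∃[ i ] Shift d t p (toℕ (at i)) × Shift d (suc t) p (toℕ (at (next i)))
  drift zero = zero , base d , s
  drift (suc t) with drift t
  ... | i , s₀ , s₁ = next i , s₁ ,
    shift-on d s₀ s₁ (at-next C (next i)) (at-next² C i ∘ toℕ-injective)

  escape : ∀ d → (∃[ i ] Shift d n p (toℕ (at i)) × Shift d (suc n) p (toℕ (at (next i)))) → ⊥
  escape up   (i , s₀ , _) = <⇒≱ (toℕ<n (at i)) (subst (n ≤_) (sym s₀) (m≤m+n n p))
  escape down (i , s₀ , _) = <⇒≱ (toℕ<n (at zero)) (subst (n ≤_) (sym s₀) (m≤m+n n _))

pathGraph-isTree : ∀ {n} → Fin n → IsTree (pathGraph n)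
pathGraph-isTree {n} root = record
  { nonempty  = root
  ; connected = λ p q → convex⇒star {R = Graph._~_ (pathGraph n)} swap id {P = λ _ → Fin n}
                  (λ _ _ _ _ → root) (λ _ _ → inj₁) {p} {q} root root
  ; acyclic   = pathGraph-acyclic
  }

-- The bag of s holds u s, a companion of s and all v i except the last one.  The
-- last v i has the single neighbour u_m, m = 2^k′, and needs only the bag of u_m.
-- The companion of s is the neighbour of u s towards u_m, or the last v i at u_m.
module PathDecomposition (k′ : ℕ) where

  k m : ℕ
  k = suc k′
  m = 2 ^ k′

  private module Gk = Graph (G k)

  Node : Set
  Node = Fin (2 ^ k ∸ 1)

  data Companion (s : Node) : GkVertex k → Set where
    right : ∀ {p} → pos k s < m → pos k p ≡ suc (pos k s) → Companion s (u p)
    last  : pos k s ≡ m → Companion s (v (fromℕ k′))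
    left  : ∀ {p} → m < pos k s → pos k s ≡ suc (pos k p) → Companion s (u p)

  m<2^k : m < 2 ^ k
  m<2^k = ^-monoʳ-< 2 (s≤s z<s) (n<1+n k′)

  companion : ∀ s → ∃[ x ] Companion s x
  companion s with <-cmp (pos k s) m
  ... | tri≈ _ s≡m _ = _ , last s≡m
  ... | tri< s<m _ _ with path-vertex {k} (s≤s z≤n) (≤-<-trans s<m m<2^k)
  ...   | p , e = u p , right s<m e
  companion s | tri> _ _ m<s
    with path-vertex {k} (≤-trans (m^n>0 2 k′) (≤-pred m<s)) (<-trans (n<1+n _) (pos<2^k {k} s))
  ...   | p , e = u p , left m<s (cong suc (sym e))

  companion-unique : ∀ {s x y} → Companion s x → Companion s y → x ≡ y
  companion-unique (right _ e)   (right _ e′)  = cong inj₁ (pos-injective {k} (trans e (sym e′)))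
  companion-unique (right s<m _) (last e)      = ⊥-elim (<⇒≢ s<m e)
  companion-unique (right s<m _) (left m<s _)  = ⊥-elim (<-asym s<m m<s)
  companion-unique (last e)      (right s<m _) = ⊥-elim (<⇒≢ s<m e)
  companion-unique (last _)      (last _)      = refl
  companion-unique (last e)      (left m<s _)  = ⊥-elim (<⇒≢ m<s (sym e))
  companion-unique (left m<s _)  (right s<m _) = ⊥-elim (<-asym s<m m<s)
  companion-unique (left m<s _)  (last e)      = ⊥-elim (<⇒≢ m<s (sym e))
  companion-unique (left _ e)    (left _ e′)   =
    cong inj₁ (pos-injective {k} (suc-injective (trans (sym e) e′)))

  data InBag (s : Node) : GkVertex k → Set where
    self  : InBag s (u s)
    other : ∀ {x} → Companion s x → InBag s x
    apex  : ∀ i → InBag s (v (inject₁ i))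

  members : Node → List (GkVertex k)
  members s = u s ∷ proj₁ (companion s) ∷ tabulate (inj₂ ∘ inject₁ {k′})

  members⁺ : ∀ {s x} → InBag s x → x ∈ members s
  members⁺ self      = here refl
  members⁺ {s} (other c) = there (here (companion-unique c (proj₂ (companion s))))
  members⁺ (apex i)  = there (there (∈-tabulate⁺ i))

  members⁻ : ∀ {s x} → x ∈ members s → InBag s x
  members⁻ (here refl)              = self
  members⁻ {s} (there (here refl))  = other (proj₂ (companion s))
  members⁻ (there (there x∈)) with ∈-tabulate⁻ {f = inj₂ ∘ inject₁} x∈
  ... | i , refl = apex i

  bag : Node → Subset Gk.order
  bag s = fromList (map Gk.index (members s))

  ∈bag⁺ : ∀ {s x} → InBag s x → Gk.index x ∈ˢ bag s
  ∈bag⁺ = ∈-fromList⁺ ∘ ∈-map⁺ Gk.index ∘ members⁺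

  ∈bag⁻ : ∀ {s x} → Gk.index x ∈ˢ bag s → InBag s x
  ∈bag⁻ {s} {x} x∈ with ∈-map⁻ Gk.index (∈-fromList⁻ (map Gk.index (members s)) x∈)
  ... | y , y∈ , e with refl ← index-injective (G k) {x} {y} e = members⁻ y∈

  ∣bag∣≤1+k : ∀ s → ∣ bag s ∣ ≤ suc k
  ∣bag∣≤1+k s = ≤-trans (∣fromList∣≤length (map Gk.index (members s)))
    (≤-reflexive (trans (length-map Gk.index (members s))
      (cong (λ n → suc (suc n)) (length-tabulate (inj₂ {A = Node} ∘ inject₁ {k′})))))

  middle : ∃[ s ] pos k s ≡ m
  middle = path-vertex {k} (m^n>0 2 k′) m<2^k

  last-only-at-m : ∀ {s} → InBag s (v (fromℕ k′)) → pos k s ≡ m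
  last-only-at-m = only refl
    where
    only : ∀ {s x} → x ≡ v (fromℕ k′) → InBag s x → pos k s ≡ m
    only () self
    only () (other (right _ _))
    only _  (other (last s≡m)) = s≡m
    only () (other (left _ _))
    only e  (apex i) = ⊥-elim (fromℕ≢inject₁ (inj₂-injective {A = Node} (sym e)))

  -- A bag holding `u p` belongs to `p` or to a node next to it, so a node between two such nodes is
  -- `p` or one of the two. The last apex has a single bag.
  InBag-convex : ∀ x → Convex (λ s → InBag s x)
  InBag-convex (v c) {a} {b} {d} a∋ d∋ a≤b b≤d with view c
  ... | ‵inject₁ i = apex i
  ... | ‵fromℕ     = other (last (≤-antisym
          (≤-trans (s≤s b≤d) (≤-reflexive (last-only-at-m d∋)))
          (≤-trans (≤-reflexive (sym (last-only-at-m a∋))) (s≤s a≤b))))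
  InBag-convex (u p) {a} {b} {d} a∋ d∋ a≤b b≤d with <-cmp (toℕ b) (toℕ p)
  ... | tri≈ _ b≡p _ with refl ← toℕ-injective b≡p = self
  InBag-convex (u p) {a} {b} {d} a∋ d∋ a≤b b≤d | tri< b<p _ _ = from-left a∋
    where
    from-left : InBag a (u p) → InBag b (u p)
    from-left self = ⊥-elim (<⇒≱ b<p a≤b)
    from-left (other (right a<m e))
      with refl ← toℕ-injective (≤-antisym a≤b
             (≤-pred (subst (suc (toℕ b) ≤_) (suc-injective e) b<p)))
      = other (right a<m e)
    from-left (other (left _ e)) =
      ⊥-elim (<⇒≱ b<p (≤-trans (n≤1+n _) (≤-trans (≤-reflexive (sym (suc-injective e))) a≤b)))
  InBag-convex (u p) {a} {b} {d} a∋ d∋ a≤b b≤d | tri> _ _ p<b = from-right d∋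
    where
    from-right : InBag d (u p) → InBag b (u p)
    from-right self = ⊥-elim (<⇒≱ p<b b≤d)
    from-right (other (left m<d e))
      with refl ← toℕ-injective (≤-antisym b≤d (subst (_≤ toℕ b) (sym (suc-injective e)) p<b))
      = other (left m<d e)
    from-right (other (right _ e)) =
      ⊥-elim (<⇒≱ p<b (≤-trans b≤d (≤-trans (n≤1+n _) (≤-reflexive (sym (suc-injective e))))))

  InBag-v : ∀ c → ∃[ s ] InBag s (v c)
  InBag-v c with view c
  ... | ‵inject₁ i = proj₁ middle , apex i
  ... | ‵fromℕ     = proj₁ middle , other (last (proj₂ middle))

  -- Positions are positive and below `2 ^ k`, which is `2 * m`.
  m-only-multiple : ∀ p → m ∣ pos k p → pos k p ≡ m
  m-only-multiple p (divides q e) = trans e (trans (cong (_* m) q≡1) (*-identityˡ m))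
    where
    q<2 : q < 2
    q<2 = *-cancelʳ-< m q 2 (subst (_< 2 ^ k) e (pos<2^k {k} p))
    nonzero : ∀ q → pos k p ≡ q * m → q < 2 → q ≡ 1
    nonzero (suc zero) _ _ = refl
    nonzero (suc (suc _)) _ (s≤s (s≤s ()))
    q≡1 : q ≡ 1
    q≡1 = nonzero q e q<2

  -- The bag is that of the end farther from position `m`; its companion is the other end.
  covers-uu : ∀ p q → pos k q ≡ suc (pos k p) → ∃[ s ] InBag s (u p) × InBag s (u q)
  covers-uu p q e with pos k p <? m
  ... | yes p<m = p , self , other (right p<m e)
  ... | no  p≮m = q , other (left (subst (m <_) (sym e) (s≤s (≮⇒≥ p≮m))) e) , self

  covers-uv : ∀ p c → IsLargestPower (toℕ c) (pos k p) → ∃[ s ] InBag s (u p) × InBag s (v c)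
  covers-uv p c (c∣p , _) with view c
  ... | ‵inject₁ i = p , self , apex i
  ... | ‵fromℕ     = p , self , other (last (m-only-multiple p
          (subst (λ i → 2 ^ i ∣ pos k p) (toℕ-fromℕ k′) c∣p)))

  covers : ∀ {x y} → GkAdj k x y → ∃[ s ] InBag s x × InBag s y
  covers {u p} {u q} (inj₁ e) = covers-uu p q e
  covers {u p} {u q} (inj₂ e) with covers-uu q p e
  ... | s , q∈ , p∈ = s , p∈ , q∈
  covers {u p} {v c} adj = covers-uv p c adj
  covers {v c} {u p} adj with covers-uv p c adj
  ... | s , p∈ , c∈ = s , c∈ , p∈

  decomposition : TreeDecomposition (G k)
  decomposition = record
    { tree           = pathGraph (2 ^ k ∸ 1)
    ; isTree         = pathGraph-isTree (proj₁ middle)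
    ; bag            = bag
    ; coversVertices = λ { (u p) → p , ∈bag⁺ {p} self
                         ; (v c) → let s , c∈ = InBag-v c in s , ∈bag⁺ c∈ }
    ; coversEdges    = λ x~y → let s , x∈ , y∈ = covers x~y in s , ∈bag⁺ x∈ , ∈bag⁺ y∈
    ; coherent       = λ x x∈s x∈t → convex⇒star
        (λ (A , B , a~b) → B , A , swap a~b) id {P = λ s → Gk.index x ∈ˢ bag s}
        (λ {a} {b} {c} A C a≤b b≤c → ∈bag⁺ (InBag-convex x {a} {b} {c} (∈bag⁻ A) (∈bag⁻ C) a≤b b≤c))
        (λ A B e → A , B , inj₁ e) x∈s x∈t
    }

  width≤ : TreeDecomposition.width decomposition ≤ k
  width≤ = ∸-monoˡ-≤ 1 (max≤v⁺ {v = suc k} {⊥ = 0} z≤n (tabulate⁺ ∣bag∣≤1+k))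

treewidth : ∀ {k} → 1 ≤ k → HasTreewidth (G k) k
treewidth {suc k′} 1≤k =
  (decomposition , ≤-antisym width≤ (treewidth≥ 1≤k decomposition)) , treewidth≥ 1≤k
  where open PathDecomposition k′

mainTheorem3 : ∀ (k : ℕ) → 1 ≤ k →
    Graph.order (G k) ≡ 2 ^ k + k ∸ 1
    × O₂-Free (G k)
    × ¬ (completeBipartite 3 3 ⊑ G k)
    × HasTreewidth (G k) k
mainTheorem3 k 1≤k =
  sym (+-∸-comm k (m^n>0 2 k)) , O₂-free , K₃₃-free , treewidth 1≤k
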